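{- Let $X$ be a set of $n$ individuals, of whom $\epsilon n\ge 2$ are slackers and $(1-\epsilon)n$ are workers, with $\epsilon<1$ known in advance. Every deterministic nonadaptive algorithm that identifies all the slackers in $X$ by performance-based pairwise tests must use at least $\Omega((1-\epsilon)n)$ rounds. Moreover, this bound is achieved: there is a deterministic nonadaptive algorithm that identifies all the slackers in $O((1-\epsilon)n)$ rounds of performance-based pairwise tests.
   Context: Combinatorial pair testing: the status (worker or slacker) of each individual in $X$ is initially unknown. A performance-based pairwise test $T(x,y)$ on two distinct members $x,y\in X$ returns false if both $x$ and $y$ are slackers, and returns true if at least one of $x,y$ is a worker. Tests are organized in rounds; in each round each member of $X$ may take part in at most one test. An algorithm is nonadaptive if all its tests are specified in advance, before any outcome is seen. Identifying all the slackers means determining, from the outcomes of the tests and the known number of slackers, which individuals are slackers, correctly for every possible assignment of $\epsilon n$ slackers and $(1-\epsilon)n$ workers. The implied constants are absolute. -}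

module Defs where

open import Data.Bool.Base using (Bool; not; _∧_)
open import Data.Fin.Base using (Fin)
open import Data.Fin.Subset using (Subset; ∣_∣)
open import Data.Integer.Base using (+_)
open import Data.List.Base using (List; map; length)
open import Data.List.Relation.Unary.AllPairs using (AllPairs)
open import Data.Nat.Base using (ℕ)
open import Data.Rational.Base as ℚ using (ℚ; _/_)
open import Data.Sum.Base using (_⊎_)
open import Data.Vec.Base using (lookup)
open import Relation.Binary.PropositionalEquality using (_≡_; _≢_)
open import Relation.Nullary.Negation using (¬_)

fromℕ : ℕ → ℚ
fromℕ n = + n / 1

-- The individuals are the elements of Fin n.  An assignment of statuses is
-- the subset S of slackers (inside = slacker, outside = worker).

record Test (n : ℕ) : Set where
  field
    fst      : Fin n
    snd      : Fin n
    distinct : fst ≢ snd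

_TakesPartIn_ : ∀ {n} → Fin n → Test n → Set
x TakesPartIn t = x ≡ Test.fst t ⊎ x ≡ Test.snd t

NoCommonMember : ∀ {n} → Test n → Test n → Set
NoCommonMember t u = ∀ x → x TakesPartIn t → ¬ (x TakesPartIn u)

record Round (n : ℕ) : Set where
  field
    tests      : List (Test n)
    atMostOnce : AllPairs NoCommonMember tests

-- false exactly when both members are slackers.
T : ∀ {n} → Subset n → Test n → Bool
T S t = not (lookup S (Test.fst t) ∧ lookup S (Test.snd t))

-- The outcomes of a whole schedule, in order: one list per round, one
-- Boolean per test.
outcomes : ∀ {n} → Subset n → List (Round n) → List (List Bool)
outcomes S = map (λ R → map (T S) (Round.tests R))

-- The schedule cannot depend on any outcome; only the final decoding does.
record NonadaptiveAlgorithm (n : ℕ) : Set where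
  field
    schedule : List (Round n)
    decode   : List (List Bool) → Subset n

  rounds : ℕ
  rounds = length schedule

-- The number s of slackers is known in advance, so the decoding only has to
-- be correct on assignments with exactly s slackers.
IdentifiesAllSlackers : ∀ {n} → ℕ → NonadaptiveAlgorithm n → Set
IdentifiesAllSlackers {n} s A =
  (S : Subset n) → ∣ S ∣ ≡ s → decode (outcomes S schedule) ≡ S
  where open NonadaptiveAlgorithm A

-- ε is a fraction such that s = εn individuals out of n are slackers,
-- with εn ≥ 2 and ε < 1.
record SlackerFraction (n s : ℕ) (ε : ℚ) : Set where
  field
    count : ε ℚ.* fromℕ n ≡ fromℕ s
    εn≥2  : fromℕ 2 ℚ.≤ ε ℚ.* fromℕ n
    ε<1   : ε ℚ.< ℚ.1ℚ

{-# OPTIONS --safe #-}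

-- Lower bound: the R rounds give two individuals x and y at most 2R partners
-- altogether.  If there are more than 2R workers, then s − 1 slackers can be
-- chosen among the individuals that are neither x, y nor partners of these;
-- adding x or adding y to them gives two assignments with equal outcomes.
--
-- Upper bound: with w workers, run the w + 2 rounds k = 0, …, w + 1, where
-- round k tests all pairs x ≠ y with x + y ≡ k (mod n).  Everybody is then
-- tested against at least w + 1 others, so each slacker meets a slacker in some
-- test, and the slackers are exactly the participants of failed tests.
module Submission where

open import Defs
open import Data.Nat.Base using (ℕ)
open import Data.Product.Base using (∃-syntax; _×_)
open import Data.Rational.Base using (ℚ; 0ℚ; 1ℚ; _<_; _≤_; _*_; _-_)

open import Data.Bool.Base using (Bool; true; false; not; _∧_)
import Data.Bool.Properties as Bool
open import Data.Empty using (⊥-elim)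
open import Data.Fin.Base as Fin using (Fin; zero; suc; toℕ; fromℕ<; inject≤)
open import Data.Fin.Properties as Fin using (toℕ<n; toℕ-fromℕ<; toℕ-injective; inject≤-injective)
open import Data.Fin.Subset
  using (Subset; inside; outside; _∈_; _∉_; _⊆_; _∪_; ∁; ⊥; ⁅_⁆; ∣_∣)
  renaming (_-_ to _∖_)
open import Data.Fin.Subset.Properties
open import Data.Integer.Base as ℤ using (+_)
import Data.Integer.Properties as ℤ
open import Data.List.Base using (List; []; _∷_; map; length; tabulate; concat)
import Data.List.Properties as List
import Data.List.Membership.Propositional as List
open import Data.List.Membership.Propositional.Properties using (∈-tabulate⁺; ∈-concat⁺′)
open import Data.List.Relation.Unary.All as All using (All; []; _∷_)
import Data.List.Relation.Unary.All.Properties as All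
open import Data.List.Relation.Unary.AllPairs using (AllPairs; []; _∷_)
import Data.List.Relation.Unary.AllPairs.Properties as AllPairs
open import Data.List.Relation.Unary.Any using (here; there)
open import Data.Nat.Base as ℕ using (zero; suc; z≤n; s≤s)
import Data.Nat.Properties as ℕ
open import Data.Nat.Coprimality using (1-coprimeTo) renaming (sym to coprime-sym)
open import Data.Product.Base using (∃; _,_; proj₁; proj₂)
open import Data.Rational.Base as ℚ using (mkℚ; _/_; ½; *≤*)
import Data.Rational.Properties as ℚ
open import Data.Sum.Base using (_⊎_; inj₁; inj₂; [_,_]′)
open import Data.Vec.Base using ([]; _∷_; here; there; lookup; _[_]≔_)
open import Data.Vec.Properties using ([]=⇒lookup; lookup⇒[]=; lookup∘update; lookup∘update′)
open import Function.Base using (_∘_; case_of_)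
open import Relation.Binary.Definitions using (tri<; tri≈; tri>)
open import Relation.Binary.PropositionalEquality
open import Relation.Nullary using (¬_; Dec; yes; no; contradiction)
open import Relation.Nullary.Decidable using (¬?; _×-dec_; _⊎-dec_)

private variable
  n : ℕ

-- Subsets of a finite set

∣p∪q∣≤∣p∣+∣q∣ : (p q : Subset n) → ∣ p ∪ q ∣ ℕ.≤ ∣ p ∣ ℕ.+ ∣ q ∣
∣p∪q∣≤∣p∣+∣q∣ []            []            = z≤n
∣p∪q∣≤∣p∣+∣q∣ (outside ∷ p) (outside ∷ q) = ∣p∪q∣≤∣p∣+∣q∣ p q
∣p∪q∣≤∣p∣+∣q∣ (outside ∷ p) (inside  ∷ q) =
  ℕ.≤-trans (s≤s (∣p∪q∣≤∣p∣+∣q∣ p q)) (ℕ.≤-reflexive (sym (ℕ.+-suc ∣ p ∣ ∣ q ∣)))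
∣p∪q∣≤∣p∣+∣q∣ (inside  ∷ p) (y       ∷ q) =
  s≤s (ℕ.≤-trans (∣p∪q∣≤∣p∣+∣q∣ p q) (ℕ.+-monoʳ-≤ ∣ p ∣ (∣p∣≤∣x∷p∣ y q)))

subset-of-size : (p : Subset n) (k : ℕ) → k ℕ.≤ ∣ p ∣ → ∃[ q ] (q ⊆ p × ∣ q ∣ ≡ k)
subset-of-size {n} p zero _ = ⊥ , ⊥-elim ∘ ∉⊥ , ∣⊥∣≡0 n
subset-of-size (outside ∷ p) (suc k) k<∣p∣ =
  let q , q⊆p , ∣q∣≡k = subset-of-size p (suc k) k<∣p∣ in
  outside ∷ q , out⊆ q⊆p , ∣q∣≡k
subset-of-size (inside ∷ p) (suc k) (s≤s k≤∣p∣) =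
  let q , q⊆p , ∣q∣≡k = subset-of-size p k k≤∣p∣ in
  inside ∷ q , s⊆s q⊆p , cong suc ∣q∣≡k

x∉p⇒lookup≡outside : {x : Fin n} {p : Subset n} → x ∉ p → lookup p x ≡ outside
x∉p⇒lookup≡outside {x = x} {p} x∉p = Bool.¬-not (x∉p ∘ lookup⇒[]= x p)

∣p[x]≔inside∣ : {x : Fin n} {p : Subset n} → x ∉ p → ∣ p [ x ]≔ inside ∣ ≡ suc ∣ p ∣
∣p[x]≔inside∣ {x = zero}  {outside ∷ p} x∉p = refl
∣p[x]≔inside∣ {x = zero}  {inside  ∷ p} x∉p = contradiction here x∉p
∣p[x]≔inside∣ {x = suc x} {outside ∷ p} x∉p = ∣p[x]≔inside∣ (x∉p ∘ there)
∣p[x]≔inside∣ {x = suc x} {inside  ∷ p} x∉p = cong suc (∣p[x]≔inside∣ (x∉p ∘ there))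

x∉p[y]≔inside : {x y : Fin n} {p : Subset n} → x ≢ y → x ∉ p → x ∉ p [ y ]≔ inside
x∉p[y]≔inside {x = x} {p = p} x≢y x∉p x∈p′ = x∉p (lookup⇒[]= x p
  (trans (sym (lookup∘update′ x≢y p inside)) ([]=⇒lookup x∈p′)))

-- By injectivity the later values survive the removal of `f zero`, and this removal makes `p`
-- strictly smaller, so induction on `m` applies.
injection⇒≤∣p∣ : ∀ {m} (f : Fin m → Fin n) → (∀ {i j} → f i ≡ f j → i ≡ j) →
                 (p : Subset n) → (∀ i → f i ∈ p) → m ℕ.≤ ∣ p ∣
injection⇒≤∣p∣ {m = zero}  f f-inj p f∈p = z≤n
injection⇒≤∣p∣ {m = suc m} f f-inj p f∈p = ℕ.≤-trans
  (s≤s (injection⇒≤∣p∣ (f ∘ suc) (Fin.suc-injective ∘ f-inj) (p ∖ f zero)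
    λ i → x∈p∧x≢y⇒x∈p-y (f∈p (suc i)) λ eq → case f-inj eq of λ ()))
  (x∈p⇒∣p-x∣<∣p∣ (f∈p zero))

-- Outcomes of tests

worker⇒T≡true : {S : Subset n} (t : Test n) {x : Fin n} →
                x TakesPartIn t → x ∉ S → T S t ≡ true
worker⇒T≡true {S = S} t (inj₁ refl) x∉S rewrite x∉p⇒lookup≡outside x∉S = refl
worker⇒T≡true {S = S} t (inj₂ refl) x∉S rewrite x∉p⇒lookup≡outside x∉S =
  cong not (Bool.∧-zeroʳ (lookup S (Test.fst t)))

T≡false⇒slacker : {S : Subset n} (t : Test n) {x : Fin n} →
                  x TakesPartIn t → T S t ≡ false → x ∈ S
T≡false⇒slacker {S = S} t {x} x∈t eq with x ∈? S
... | yes x∈S = x∈S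
... | no  x∉S = case trans (sym (worker⇒T≡true t x∈t x∉S)) eq of λ ()

slackers⇒T≡false : {S : Subset n} (t : Test n) →
                   Test.fst t ∈ S → Test.snd t ∈ S → T S t ≡ false
slackers⇒T≡false t fst∈S snd∈S rewrite []=⇒lookup fst∈S | []=⇒lookup snd∈S = refl

T-cong : (S S′ : Subset n) (t : Test n) →
         (∀ {x} → x TakesPartIn t → lookup S x ≡ lookup S′ x) → T S t ≡ T S′ t
T-cong S S′ t eq = cong₂ (λ a b → not (a ∧ b)) (eq (inj₁ refl)) (eq (inj₂ refl))

-- Used twice, for rounds and then for tests, to pass from equal outcome lists to equal outcomes of
-- one test.
map-≡⁻ : {A B : Set} {f g : A → B} {xs : List A} {x : A} →
         map f xs ≡ map g xs → x List.∈ xs → f x ≡ g x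
map-≡⁻ {xs = _ ∷ _} eq (here refl) = List.∷-injectiveˡ eq
map-≡⁻ {xs = _ ∷ _} eq (there x∈xs) = map-≡⁻ (List.∷-injectiveʳ eq) x∈xs

-- Identification as separation of assignments

Separates : ℕ → List (Round n) → Set
Separates s Rs = ∀ {S S′} → ∣ S ∣ ≡ s → ∣ S′ ∣ ≡ s → outcomes S Rs ≡ outcomes S′ Rs → S ≡ S′

identifies⇒separates : ∀ {s} (A : NonadaptiveAlgorithm n) → IdentifiesAllSlackers s A →
                       Separates s (NonadaptiveAlgorithm.schedule A)
identifies⇒separates A ident {S} {S′} ∣S∣≡s ∣S′∣≡s eq =
  trans (sym (ident S ∣S∣≡s)) (trans (cong decode eq) (ident S′ ∣S′∣≡s))
  where open NonadaptiveAlgorithm A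

consistent? : (s : ℕ) (Rs : List (Round n)) (o : List (List Bool)) →
              Dec (∃[ S ] (∣ S ∣ ≡ s × outcomes S Rs ≡ o))
consistent? s Rs o = anySubset? λ S →
  (∣ S ∣ ℕ.≟ s) ×-dec List.≡-dec (List.≡-dec Bool._≟_) (outcomes S Rs) o

-- Only rounds are counted, so decoding may search all subsets for one consistent with the outcomes.
-- This reduces the upper bound to a schedule that separates assignments.
exhaustiveSearch : ℕ → List (Round n) → NonadaptiveAlgorithm n
exhaustiveSearch s Rs = record
  { schedule = Rs
  ; decode   = λ o → case consistent? s Rs o of λ where
      (yes (S , _)) → S
      -- Never reached on the outcomes of an assignment with `s` slackers, since that assignment is
      -- itself consistent.
      (no _)        → ⊥
  }

separates⇒identifies : ∀ {s} {Rs : List (Round n)} → Separates s Rs →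
                       IdentifiesAllSlackers s (exhaustiveSearch s Rs)
separates⇒identifies {s = s} {Rs} sep S ∣S∣≡s with consistent? s Rs (outcomes S Rs)
... | yes (S′ , ∣S′∣≡s , eq) = sep ∣S′∣≡s ∣S∣≡s eq
... | no  none               = contradiction (S , ∣S∣≡s , refl) none

-- Lower bound

-- Quantifying over every member `y` of the test treats its two positions alike. The set `p` may be
-- larger than necessary, so the sets found for single rounds can be united.
PartnersIn : Fin n → Subset n → Test n → Set
PartnersIn x p t = ∀ y → x TakesPartIn t → y TakesPartIn t → y ≡ x ⊎ y ∈ p

PartnersIn-⊆ : ∀ {x : Fin n} {p q} t → p ⊆ q → PartnersIn x p t → PartnersIn x q t
PartnersIn-⊆ t p⊆q h y x∈t y∈t = [ inj₁ , inj₂ ∘ p⊆q ]′ (h y x∈t y∈t)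

-- Once a test with `x` is found, its other member is the only partner: the remaining tests of the
-- round avoid `x`, so the condition on them is vacuous.
partners-round : (x : Fin n) {ts : List (Test n)} → AllPairs NoCommonMember ts →
                 ∃[ p ] (∣ p ∣ ℕ.≤ 1 × All (PartnersIn x p) ts)
partners-round {n} x {[]} [] = ⊥ , ℕ.≤-trans (ℕ.≤-reflexive (∣⊥∣≡0 n)) z≤n , []
partners-round x {t ∷ ts} (t∥ts ∷ ts∥) with x Fin.≟ Test.fst t | x Fin.≟ Test.snd t
... | yes refl | _ =
  ⁅ Test.snd t ⁆ , ℕ.≤-reflexive (∣⁅x⁆∣≡1 (Test.snd t)) ,
  (λ { _ _ (inj₁ refl) → inj₁ refl ; _ _ (inj₂ refl) → inj₂ (x∈⁅x⁆ _) }) ∷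
  All.map (λ t∥u _ x∈u → contradiction x∈u (t∥u x (inj₁ refl))) t∥ts
... | no _ | yes refl =
  ⁅ Test.fst t ⁆ , ℕ.≤-reflexive (∣⁅x⁆∣≡1 (Test.fst t)) ,
  (λ { _ _ (inj₂ refl) → inj₁ refl ; _ _ (inj₁ refl) → inj₂ (x∈⁅x⁆ _) }) ∷
  All.map (λ t∥u _ x∈u → contradiction x∈u (t∥u x (inj₂ refl))) t∥ts
... | no x≢fst | no x≢snd =
  let p , ∣p∣≤1 , partners = partners-round x ts∥ in
  p , ∣p∣≤1 , (λ _ x∈t → contradiction x∈t [ x≢fst , x≢snd ]′) ∷ partners

partners : (x : Fin n) (Rs : List (Round n)) →
           ∃[ p ] (∣ p ∣ ℕ.≤ length Rs × All (All (PartnersIn x p) ∘ Round.tests) Rs)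
partners {n} x []       = ⊥ , ℕ.≤-reflexive (∣⊥∣≡0 n) , []
partners {n} x (R ∷ Rs) =
  let p , ∣p∣≤1 , pR  = partners-round x (Round.atMostOnce R)
      q , ∣q∣≤r , qRs = partners x Rs
  in  p ∪ q , ℕ.≤-trans (∣p∪q∣≤∣p∣+∣q∣ p q) (ℕ.+-mono-≤ ∣p∣≤1 ∣q∣≤r) ,
      All.map (λ {t} → PartnersIn-⊆ t (p⊆p∪q q)) pR ∷
      All.map (All.map (λ {t} → PartnersIn-⊆ t (q⊆p∪q p q))) qRs

partner : {x : Fin n} (t : Test n) → x TakesPartIn t → ∃[ y ] (y TakesPartIn t × y ≢ x)
partner t (inj₁ refl) = Test.snd t , inj₂ refl , Test.distinct t ∘ sym
partner t (inj₂ refl) = Test.fst t , inj₁ refl , Test.distinct t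

_takesPartIn?_ : (x : Fin n) (t : Test n) → Dec (x TakesPartIn t)
x takesPartIn? t = (x Fin.≟ Test.fst t) ⊎-dec (x Fin.≟ Test.snd t)

-- The other member of the test lies outside `p` and differs from `x`, so it is still a worker after
-- `x` becomes a slacker.
T-extension : {x : Fin n} {p : Subset n} (t : Test n) → PartnersIn x (∁ p) t →
              x TakesPartIn t → T (p [ x ]≔ inside) t ≡ true
T-extension t x-free x∈t with partner t x∈t
... | y , y∈t , y≢x with x-free y x∈t y∈t
... | inj₁ y≡x  = contradiction y≡x y≢x
... | inj₂ y∈∁p = worker⇒T≡true t y∈t (x∉p[y]≔inside y≢x (x∈∁p⇒x∉p y∈∁p))

-- A test with `x` or `y` contains a worker under both assignments: either that individual itself,
-- or its partner. Any other test sees only statuses on which the two assignments agree.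
T-exchange : {x y : Fin n} {p : Subset n} → x ≢ y → x ∉ p → y ∉ p → (t : Test n) →
             PartnersIn x (∁ p) t → PartnersIn y (∁ p) t →
             T (p [ x ]≔ inside) t ≡ T (p [ y ]≔ inside) t
T-exchange {x = x} {y} {p} x≢y x∉p y∉p t x-free y-free
  with x takesPartIn? t | y takesPartIn? t
... | yes x∈t | _ = trans (T-extension t x-free x∈t)
                          (sym (worker⇒T≡true t x∈t (x∉p[y]≔inside x≢y x∉p)))
... | no _ | yes y∈t = trans (worker⇒T≡true t y∈t (x∉p[y]≔inside (x≢y ∘ sym) y∉p))
                             (sym (T-extension t y-free y∈t))
... | no x∉t | no y∉t = T-cong (p [ x ]≔ inside) (p [ y ]≔ inside) t λ z∈t → trans
  (lookup∘update′ (λ { refl → x∉t z∈t }) p inside)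
  (sym (lookup∘update′ (λ { refl → y∉t z∈t }) p inside))

separates⇒workers≤2*rounds : ∀ {s w} {x y : Fin n} → x ≢ y → suc s ℕ.+ w ≡ n →
  {Rs : List (Round n)} → Separates (suc s) Rs → w ℕ.≤ 2 ℕ.* length Rs
separates⇒workers≤2*rounds {n} {s} {w} {x} {y} x≢y s+w≡n {Rs} sep = ℕ.≮⇒≥ λ 2r<w →
  let
    px , ∣px∣≤r , x-partners = partners x Rs
    py , ∣py∣≤r , y-partners = partners y Rs
    F = (⁅ x ⁆ ∪ ⁅ y ⁆) ∪ (px ∪ py)

    -- The strictness of `2r<w` absorbs one of the two units contributed by `x` and `y`. As n = s +
    -- (1 + w), exactly enough room remains outside `F` for the `s` common slackers.
    ∣F∣≤1+w : ∣ F ∣ ℕ.≤ suc w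
    ∣F∣≤1+w = begin
      ∣ F ∣
        ≤⟨ ∣p∪q∣≤∣p∣+∣q∣ (⁅ x ⁆ ∪ ⁅ y ⁆) (px ∪ py) ⟩
      ∣ ⁅ x ⁆ ∪ ⁅ y ⁆ ∣ ℕ.+ ∣ px ∪ py ∣
        ≤⟨ ℕ.+-mono-≤ (∣p∪q∣≤∣p∣+∣q∣ ⁅ x ⁆ ⁅ y ⁆) (∣p∪q∣≤∣p∣+∣q∣ px py) ⟩
      (∣ ⁅ x ⁆ ∣ ℕ.+ ∣ ⁅ y ⁆ ∣) ℕ.+ (∣ px ∣ ℕ.+ ∣ py ∣)
        ≤⟨ ℕ.+-mono-≤ (ℕ.≤-reflexive (cong₂ ℕ._+_ (∣⁅x⁆∣≡1 x) (∣⁅x⁆∣≡1 y)))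
                      (ℕ.+-mono-≤ ∣px∣≤r ∣py∣≤r) ⟩
      2 ℕ.+ (length Rs ℕ.+ length Rs)
        ≡⟨ cong (λ r → 2 ℕ.+ (length Rs ℕ.+ r)) (sym (ℕ.+-identityʳ (length Rs))) ⟩
      2 ℕ.+ 2 ℕ.* length Rs
        ≤⟨ s≤s 2r<w ⟩
      suc w
        ∎

    s≤∣∁F∣ : s ℕ.≤ ∣ ∁ F ∣
    s≤∣∁F∣ = begin
      s                      ≡⟨ ℕ.m+n∸n≡m s (suc w) ⟨
      s ℕ.+ suc w ℕ.∸ suc w  ≡⟨ cong (ℕ._∸ suc w) (trans (ℕ.+-suc s w) s+w≡n) ⟩
      n ℕ.∸ suc w            ≤⟨ ℕ.∸-monoʳ-≤ n ∣F∣≤1+w ⟩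
      n ℕ.∸ ∣ F ∣            ≡⟨ ∣∁p∣≡n∸∣p∣ F ⟨
      ∣ ∁ F ∣                ∎

    -- `q` is the common part of the two confusable assignments; `x` or `y` becomes the last
    -- slacker.
    q , q⊆∁F , ∣q∣≡s = subset-of-size (∁ F) s s≤∣∁F∣

    F⊆∁q : F ⊆ ∁ q
    F⊆∁q z∈F = x∉p⇒x∈∁p λ z∈q → x∈∁p⇒x∉p (q⊆∁F z∈q) z∈F

    x∉q = x∈∁p⇒x∉p (F⊆∁q (p⊆p∪q (px ∪ py) (p⊆p∪q ⁅ y ⁆ (x∈⁅x⁆ x))))
    y∉q = x∈∁p⇒x∉p (F⊆∁q (p⊆p∪q (px ∪ py) (q⊆p∪q ⁅ x ⁆ ⁅ y ⁆ (x∈⁅x⁆ y))))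

    px⊆∁q : px ⊆ ∁ q
    px⊆∁q = F⊆∁q ∘ q⊆p∪q (⁅ x ⁆ ∪ ⁅ y ⁆) (px ∪ py) ∘ p⊆p∪q py
    py⊆∁q : py ⊆ ∁ q
    py⊆∁q = F⊆∁q ∘ q⊆p∪q (⁅ x ⁆ ∪ ⁅ y ⁆) (px ∪ py) ∘ q⊆p∪q px py

    sameOutcomes : outcomes (q [ x ]≔ inside) Rs ≡ outcomes (q [ y ]≔ inside) Rs
    sameOutcomes = List.map-cong-local (All.zipWith
      (λ (x-free , y-free) → List.map-cong-local (All.zipWith
        (λ {t} (x-free , y-free) → T-exchange x≢y x∉q y∉q t
          (PartnersIn-⊆ t px⊆∁q x-free) (PartnersIn-⊆ t py⊆∁q y-free))
        (x-free , y-free)))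
      (x-partners , y-partners))

    S≡S′ = sep (trans (∣p[x]≔inside∣ x∉q) (cong suc ∣q∣≡s))
               (trans (∣p[x]≔inside∣ y∉q) (cong suc ∣q∣≡s)) sameOutcomes
  in x∉p[y]≔inside x≢y x∉q
       (subst (x ∈_) S≡S′ (lookup⇒[]= x (q [ x ]≔ inside) (lookup∘update x q inside)))
  where open ℕ.≤-Reasoning

-- Upper bound

-- The two-element orbits of an involution are disjoint pairs, hence form a legal round; fixed
-- points sit it out.
module Involution (σ : Fin n → Fin n) (σ-involutive : ∀ x → σ (σ x) ≡ x) where

  -- Each orbit is tested once, from its smaller element. The decision is an argument so that the
  -- lemmas below can split on it directly.
  testFrom : (x : Fin n) → Dec (x Fin.< σ x) → List (Test n)
  testFrom x (yes x<σx) = record { fst = x ; snd = σ x ; distinct = Fin.<⇒≢ x<σx } ∷ []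
  testFrom x (no _)     = []

  testsFrom : Fin n → List (Test n)
  testsFrom x = testFrom x (x Fin.<? σ x)

  testFrom-atMostOnce : ∀ x d → AllPairs NoCommonMember (testFrom x d)
  testFrom-atMostOnce x (yes _) = [] ∷ []
  testFrom-atMostOnce x (no _)  = []

  testFrom-disjoint : ∀ {x y} → x ≢ y → ∀ d e →
                      All (λ t → All (NoCommonMember t) (testFrom y e)) (testFrom x d)
  testFrom-disjoint x≢y (no _)     _          = []
  testFrom-disjoint x≢y (yes _)    (no _)     = [] ∷ []
  testFrom-disjoint {x} {y} x≢y (yes x<σx) (yes y<σy) = (disjoint ∷ []) ∷ []
    where
    disjoint : ∀ z → z ≡ x ⊎ z ≡ σ x → ¬ (z ≡ y ⊎ z ≡ σ y)
    disjoint _ (inj₁ refl) (inj₁ refl) = x≢y refl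
    -- If the smaller end of one pair is the larger end of the other, both pairs are the same orbit
    -- listed in opposite orders, which contradicts the inequalities.
    disjoint _ (inj₁ refl) (inj₂ refl) =
      Fin.<-asym y<σy (subst (σ y Fin.<_) (σ-involutive y) x<σx)
    disjoint _ (inj₂ refl) (inj₁ refl) =
      Fin.<-asym x<σx (subst (σ x Fin.<_) (σ-involutive x) y<σy)
    disjoint _ (inj₂ refl) (inj₂ σx≡σy) =
      x≢y (trans (sym (σ-involutive x)) (trans (cong σ σx≡σy) (σ-involutive y)))

  round : Round n
  round = record
    { tests      = concat (tabulate testsFrom)
    ; atMostOnce = AllPairs.concat⁺
        (All.tabulate⁺ λ x → testFrom-atMostOnce x (x Fin.<? σ x))
        (AllPairs.tabulate⁺ λ {x} {y} x≢y → testFrom-disjoint x≢y (x Fin.<? σ x) (y Fin.<? σ y))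
    }

  testFrom-∈ : ∀ {x} → x Fin.< σ x → ∀ d →
               ∃[ t ] (t List.∈ testFrom x d × Test.fst t ≡ x × Test.snd t ≡ σ x)
  testFrom-∈ x<σx (yes _)    = _ , here refl , refl , refl
  testFrom-∈ x<σx (no  x≮σx) = contradiction x<σx x≮σx

  round-∈ : ∀ {x} → x Fin.< σ x →
            ∃[ t ] (t List.∈ Round.tests round × Test.fst t ≡ x × Test.snd t ≡ σ x)
  round-∈ {x} x<σx =
    let t , t∈x , ends = testFrom-∈ x<σx (x Fin.<? σ x)
    in  t , ∈-concat⁺′ t∈x (∈-tabulate⁺ x) , ends

  -- The orbit of `x` is tested from `x` or from `σ x`, whichever is smaller; in the second case
  -- involutivity identifies the other end with `x`.
  round-complete : ∀ {x} → x ≢ σ x → {S : Subset n} → x ∈ S → σ x ∈ S →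
                   ∃[ t ] (t List.∈ Round.tests round × x TakesPartIn t × T S t ≡ false)
  round-complete {x} x≢σx x∈S σx∈S with Fin.<-cmp x (σ x)
  ... | tri≈ _ x≡σx _ = contradiction x≡σx x≢σx
  ... | tri< x<σx _ _ with round-∈ x<σx
  ...   | t , t∈ , refl , snd≡ =
    t , t∈ , inj₁ refl , slackers⇒T≡false t x∈S (subst (_∈ _) (sym snd≡) σx∈S)
  round-complete {x} x≢σx x∈S σx∈S | tri> _ _ σx<x
    with round-∈ (subst (σ x Fin.<_) (sym (σ-involutive x)) σx<x)
  ... | t , t∈ , fst≡ , snd≡ =
    t , t∈ , inj₂ (sym (trans snd≡ (σ-involutive x))) ,
    slackers⇒T≡false t (subst (_∈ _) (sym fst≡) σx∈S)
                       (subst (_∈ _) (sym (trans snd≡ (σ-involutive x))) x∈S)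

-- x + y ≡ k (mod n), for x, y and k below n.
Reflects : Fin n → Fin n → Fin n → Set
Reflects {n} k x y = toℕ x ℕ.+ toℕ y ≡ toℕ k ⊎ toℕ x ℕ.+ toℕ y ≡ n ℕ.+ toℕ k

n+i≢toℕ : ∀ i (j : Fin n) → n ℕ.+ i ≢ toℕ j
n+i≢toℕ {n} i j eq = ℕ.<⇒≱ (toℕ<n j) (subst (n ℕ.≤_) eq (ℕ.m≤m+n n i))

-- The witness is k - x, or n + k - x when k < x. The first is at most k, and the second is below n
-- because k < x.
reflection : (k x : Fin n) → ∃ (Reflects k x)
reflection {n} k x with toℕ x ℕ.≤? toℕ k
... | yes x≤k = fromℕ< k∸x<n ,
  inj₁ (trans (cong (toℕ x ℕ.+_) (toℕ-fromℕ< k∸x<n)) (ℕ.m+[n∸m]≡n x≤k))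
  where k∸x<n = ℕ.≤-<-trans (ℕ.m∸n≤m (toℕ k) (toℕ x)) (toℕ<n k)
... | no x≰k = fromℕ< n+k∸x<n ,
  inj₂ (trans (cong (toℕ x ℕ.+_) (toℕ-fromℕ< n+k∸x<n)) (ℕ.m+[n∸m]≡n x≤n+k))
  where
  x≤n+k : toℕ x ℕ.≤ n ℕ.+ toℕ k
  x≤n+k = ℕ.≤-trans (ℕ.<⇒≤ (toℕ<n x)) (ℕ.m≤m+n n (toℕ k))
  n+k∸x<n : n ℕ.+ toℕ k ℕ.∸ toℕ x ℕ.< n
  n+k∸x<n = subst (n ℕ.+ toℕ k ℕ.∸ toℕ x ℕ.<_) (ℕ.m+n∸n≡m n (toℕ x))
    (ℕ.∸-monoˡ-< (ℕ.+-monoʳ-< n (ℕ.≰⇒> x≰k)) x≤n+k)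

Reflects-sym : {k x y : Fin n} → Reflects k x y → Reflects k y x
Reflects-sym {x = x} {y} = [ inj₁ ∘ trans y+x≡x+y , inj₂ ∘ trans y+x≡x+y ]′
  where y+x≡x+y = ℕ.+-comm (toℕ y) (toℕ x)

-- Handles the mixed cases of `Reflects-unique`: two reflections of the same element would differ by
-- n, although both are below n.
+-cancelˡ-shift : ∀ m n {a b k} → m ℕ.+ a ≡ k → m ℕ.+ b ≡ n ℕ.+ k → n ℕ.+ a ≡ b
+-cancelˡ-shift m n {a} {b} {k} p q = ℕ.+-cancelˡ-≡ m _ _ (begin
  m ℕ.+ (n ℕ.+ a)  ≡⟨ ℕ.+-assoc m n a ⟨
  m ℕ.+ n ℕ.+ a    ≡⟨ cong (ℕ._+ a) (ℕ.+-comm m n) ⟩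
  n ℕ.+ m ℕ.+ a    ≡⟨ ℕ.+-assoc n m a ⟩
  n ℕ.+ (m ℕ.+ a)  ≡⟨ cong (n ℕ.+_) p ⟩
  n ℕ.+ k          ≡⟨ q ⟨
  m ℕ.+ b          ∎)
  where open ≡-Reasoning

Reflects-unique : {k x y z : Fin n} → Reflects k x y → Reflects k x z → y ≡ z
Reflects-unique {x = x} (inj₁ p) (inj₁ q) =
  toℕ-injective (ℕ.+-cancelˡ-≡ (toℕ x) _ _ (trans p (sym q)))
Reflects-unique {x = x} (inj₂ p) (inj₂ q) =
  toℕ-injective (ℕ.+-cancelˡ-≡ (toℕ x) _ _ (trans p (sym q)))
Reflects-unique {n} {x = x} {y} {z} (inj₁ p) (inj₂ q) =
  contradiction (+-cancelˡ-shift (toℕ x) n p q) (n+i≢toℕ (toℕ y) z)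
Reflects-unique {n} {x = x} {y} {z} (inj₂ p) (inj₁ q) =
  contradiction (+-cancelˡ-shift (toℕ x) n q p) (n+i≢toℕ (toℕ z) y)

Reflects-injective : {k l x y : Fin n} → Reflects k x y → Reflects l x y → k ≡ l
Reflects-injective (inj₁ p) (inj₁ q) = toℕ-injective (trans (sym p) q)
Reflects-injective {n} (inj₂ p) (inj₂ q) = toℕ-injective (ℕ.+-cancelˡ-≡ n _ _ (trans (sym p) q))
Reflects-injective {k = k} {l} (inj₁ p) (inj₂ q) = contradiction (trans (sym q) p) (n+i≢toℕ (toℕ l) k)
Reflects-injective {k = k} {l} (inj₂ p) (inj₁ q) = contradiction (trans (sym p) q) (n+i≢toℕ (toℕ k) l)

reflect : Fin n → Fin n → Fin n
reflect k x = proj₁ (reflection k x)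

-- The relation is symmetric, so `x` is itself a reflection of `reflect k x`, and reflections are
-- unique.
reflect-involutive : (k x : Fin n) → reflect k (reflect k x) ≡ x
reflect-involutive k x = Reflects-unique {k = k}
  (proj₂ (reflection k (reflect k x))) (Reflects-sym {k = k} {x} (proj₂ (reflection k x)))

-- For a fixed `x`, different rounds give different reflections; this feeds the pigeonhole argument
-- in `slackerPartner`.
reflect-injective : {k l x : Fin n} → reflect k x ≡ reflect l x → k ≡ l
reflect-injective {k = k} {l} {x} eq = Reflects-injective {k = k} {l} {x}
  (proj₂ (reflection k x)) (subst (Reflects l x) (sym eq) (proj₂ (reflection l x)))

-- The schedule of reflections

module Reflections {n s w : ℕ} (s+w≡n : 2 ℕ.+ s ℕ.+ w ≡ n) where

  -- Here `s` counts the slackers beyond the first two. Having two slackers is what makes 2 + w sums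
  -- fit below n.
  sums : Fin (2 ℕ.+ w) → Fin n
  sums k = inject≤ k (subst (2 ℕ.+ w ℕ.≤_) s+w≡n (s≤s (s≤s (ℕ.m≤n+m w s))))

  reflectionRound : Fin n → Round n
  reflectionRound k = Involution.round (reflect k) (reflect-involutive k)

  schedule : List (Round n)
  schedule = tabulate (reflectionRound ∘ sums)

  -- Pigeonhole: `x` has 2 + w distinct reflections. If none were a slacker other than `x`, all
  -- would lie among `x` and the w workers, at most 1 + w individuals.
  slackerPartner : {S : Subset n} {x : Fin n} → ∣ S ∣ ≡ 2 ℕ.+ s →
                   ∃[ k ] (x ≢ reflect (sums k) x × reflect (sums k) x ∈ S)
  slackerPartner {S} {x} ∣S∣≡s
    with Fin.any? (λ k → ¬? (x Fin.≟ reflect (sums k) x) ×-dec (reflect (sums k) x ∈? S))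
  ... | yes found = found
  ... | no  none  = contradiction tooMany (ℕ.<⇒≱ ℕ.≤-refl)
    where
    partner∈ : ∀ k → reflect (sums k) x ∈ ⁅ x ⁆ ∪ ∁ S
    partner∈ k with x Fin.≟ reflect (sums k) x
    ... | yes x≡σx = x∈p∪q⁺ (inj₁ (subst (_∈ ⁅ x ⁆) x≡σx (x∈⁅x⁆ x)))
    ... | no  x≢σx = x∈p∪q⁺ (inj₂ (x∉p⇒x∈∁p λ σx∈S → none (k , x≢σx , σx∈S)))

    open ℕ.≤-Reasoning
    tooMany : 2 ℕ.+ w ℕ.≤ 1 ℕ.+ w
    tooMany = begin
      2 ℕ.+ w
        ≤⟨ injection⇒≤∣p∣ (λ k → reflect (sums k) x)
             (inject≤-injective _ _ _ _ ∘ reflect-injective {x = x}) _ partner∈ ⟩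
      ∣ ⁅ x ⁆ ∪ ∁ S ∣
        ≤⟨ ∣p∪q∣≤∣p∣+∣q∣ ⁅ x ⁆ (∁ S) ⟩
      ∣ ⁅ x ⁆ ∣ ℕ.+ ∣ ∁ S ∣
        ≡⟨ cong₂ ℕ._+_ (∣⁅x⁆∣≡1 x) (∣∁p∣≡n∸∣p∣ S) ⟩
      1 ℕ.+ (n ℕ.∸ ∣ S ∣)
        ≡⟨ cong₂ (λ a b → 1 ℕ.+ (a ℕ.∸ b)) (sym s+w≡n) ∣S∣≡s ⟩
      1 ℕ.+ (2 ℕ.+ s ℕ.+ w ℕ.∸ (2 ℕ.+ s))
        ≡⟨ cong (1 ℕ.+_) (ℕ.m+n∸m≡n (2 ℕ.+ s) w) ⟩
      1 ℕ.+ w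
        ∎

  -- Under `S` the slacker `x` fails a test with another slacker. The same test fails under `S′`,
  -- and a failed test has only slackers as members.
  sameOutcomes⇒⊆ : {S S′ : Subset n} → ∣ S ∣ ≡ 2 ℕ.+ s →
                   outcomes S schedule ≡ outcomes S′ schedule → S ⊆ S′
  sameOutcomes⇒⊆ {S} {S′} ∣S∣≡s eq {x} x∈S with slackerPartner {x = x} ∣S∣≡s
  ... | k , x≢σx , σx∈S
    with Involution.round-complete (reflect (sums k)) (reflect-involutive (sums k)) x≢σx x∈S σx∈S
  ... | t , t∈round , x∈t , TSt≡false =
    T≡false⇒slacker t x∈t (trans (sym TSt≡TS′t) TSt≡false)
    where TSt≡TS′t = map-≡⁻ (map-≡⁻ eq (∈-tabulate⁺ {f = reflectionRound ∘ sums} k)) t∈round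

  separates : Separates (2 ℕ.+ s) schedule
  separates ∣S∣≡s ∣S′∣≡s eq =
    ⊆-antisym (sameOutcomes⇒⊆ ∣S∣≡s eq) (sameOutcomes⇒⊆ ∣S′∣≡s (sym eq))

-- The embedding of ℕ in ℚ

-- Division normalises its arguments and is stuck on a variable numerator. Rewriting to the
-- constructor form lets sums, products and comparisons compute.
fromℕ-mkℚ : ∀ m → fromℕ m ≡ mkℚ (+ m) 0 (coprime-sym (1-coprimeTo m))
fromℕ-mkℚ m = ℚ.normalize-coprime (coprime-sym (1-coprimeTo m))

fromℕ-homo-+ : ∀ i j → fromℕ (i ℕ.+ j) ≡ fromℕ i ℚ.+ fromℕ j
fromℕ-homo-+ i j rewrite fromℕ-mkℚ i | fromℕ-mkℚ j =
  cong (_/ 1) (sym (cong₂ ℤ._+_ (ℤ.*-identityʳ (+ i)) (ℤ.*-identityʳ (+ j))))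

fromℕ-homo-* : ∀ i j → fromℕ (i ℕ.* j) ≡ fromℕ i * fromℕ j
fromℕ-homo-* i j rewrite fromℕ-mkℚ i | fromℕ-mkℚ j = cong (_/ 1) (ℤ.pos-* i j)

fromℕ-mono-≤ : ∀ {i j} → i ℕ.≤ j → fromℕ i ≤ fromℕ j
fromℕ-mono-≤ {i} {j} i≤j rewrite fromℕ-mkℚ i | fromℕ-mkℚ j =
  *≤* (ℤ.*-monoʳ-≤-nonNeg (+ 1) (ℤ.+≤+ i≤j))

fromℕ-cancel-≤ : ∀ {i j} → fromℕ i ≤ fromℕ j → i ℕ.≤ j
fromℕ-cancel-≤ {i} {j} i≤j rewrite fromℕ-mkℚ i | fromℕ-mkℚ j =
  ℤ.drop‿+≤+ (ℤ.*-cancelʳ-≤-pos (+ i) (+ j) (+ 1) (ℚ.drop-*≤* i≤j))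

fromℕ-cancel-< : ∀ {i j} → fromℕ i < fromℕ j → i ℕ.< j
fromℕ-cancel-< i<j = ℕ.≰⇒> λ j≤i → ℚ.<-irrefl refl (ℚ.<-≤-trans i<j (fromℕ-mono-≤ j≤i))

-- Numbers of slackers and workers obtained from the fraction

record Population (n s : ℕ) (ε : ℚ) : Set where
  field
    {s-2 w-1} : ℕ
    s≡        : s ≡ 2 ℕ.+ s-2
    s+w≡n     : s ℕ.+ suc w-1 ≡ n
    workers   : (1ℚ - ε) * fromℕ n ≡ fromℕ (suc w-1)

-- Two slackers come from `εn≥2`; multiplying ε < 1 by the positive n leaves at least one worker.
-- Storing the counts as `2 ℕ.+ s-2` and `suc w-1` makes both facts available by pattern matching.
population : ∀ {n s ε} → SlackerFraction n s ε → Population n s ε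
population {n} {s} {ε} sf = record
  { s≡ = sym (proj₂ 2+s-2) ; s+w≡n = s+w≡n ; workers = workers }
  where
  open SlackerFraction sf
  2≤s : 2 ℕ.≤ s
  2≤s = fromℕ-cancel-≤ (subst (fromℕ 2 ≤_) count εn≥2)
  2+s-2 = ℕ.m≤n⇒∃[o]m+o≡n 2≤s

  s≤n : s ℕ.≤ n
  s≤n = fromℕ-cancel-≤ (subst₂ _≤_ count (ℚ.*-identityˡ (fromℕ n))
    (ℚ.*-monoʳ-≤-nonNeg (fromℕ n) {{ℚ.nonNegative (fromℕ-mono-≤ {0} {n} z≤n)}} (ℚ.<⇒≤ ε<1)))

  n>0 : 0ℚ < fromℕ n
  n>0 = ℚ.<-≤-trans (ℚ.positive⁻¹ (fromℕ 2)) (fromℕ-mono-≤ (ℕ.≤-trans 2≤s s≤n))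

  s<n : s ℕ.< n
  s<n = fromℕ-cancel-< (subst₂ _<_ count (ℚ.*-identityˡ (fromℕ n))
    (ℚ.*-monoˡ-<-pos (fromℕ n) {{ℚ.positive n>0}} ε<1))

  w-1 = proj₁ (ℕ.m≤n⇒∃[o]m+o≡n s<n)

  s+w≡n : s ℕ.+ suc w-1 ≡ n
  s+w≡n = trans (ℕ.+-suc s w-1) (proj₂ (ℕ.m≤n⇒∃[o]m+o≡n s<n))

  n≡w+s : fromℕ n ≡ fromℕ (suc w-1) ℚ.+ fromℕ s
  n≡w+s = trans (cong fromℕ (trans (sym s+w≡n) (ℕ.+-comm s (suc w-1))))
                (fromℕ-homo-+ (suc w-1) s)

  open ≡-Reasoning
  workers : (1ℚ - ε) * fromℕ n ≡ fromℕ (suc w-1)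
  workers = begin
    (1ℚ - ε) * fromℕ n                               ≡⟨ ℚ.*-distribʳ-+ (fromℕ n) 1ℚ (ℚ.- ε) ⟩
    1ℚ * fromℕ n ℚ.+ ℚ.- ε * fromℕ n
      ≡⟨ cong₂ ℚ._+_ (ℚ.*-identityˡ (fromℕ n)) (sym (ℚ.neg-distribˡ-* ε (fromℕ n))) ⟩
    fromℕ n - ε * fromℕ n
      ≡⟨ cong₂ _-_ n≡w+s count ⟩
    fromℕ (suc w-1) ℚ.+ fromℕ s - fromℕ s
      ≡⟨ ℚ.+-assoc (fromℕ (suc w-1)) (fromℕ s) (ℚ.- fromℕ s) ⟩
    fromℕ (suc w-1) ℚ.+ (fromℕ s - fromℕ s)
      ≡⟨ cong (fromℕ (suc w-1) ℚ.+_) (ℚ.+-inverseʳ (fromℕ s)) ⟩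
    fromℕ (suc w-1) ℚ.+ 0ℚ                           ≡⟨ ℚ.+-identityʳ (fromℕ (suc w-1)) ⟩
    fromℕ (suc w-1)                                  ∎

-- The two bounds with explicit constants

workers≤2*rounds : (n s : ℕ) (ε : ℚ) → SlackerFraction n s ε →
  (A : NonadaptiveAlgorithm n) → IdentifiesAllSlackers s A →
  ½ * ((1ℚ - ε) * fromℕ n) ≤ fromℕ (NonadaptiveAlgorithm.rounds A)
workers≤2*rounds n s ε sf A ident with population sf
... | record { w-1 = w-1 ; s≡ = refl ; s+w≡n = refl ; workers = workers } = begin
  ½ * ((1ℚ - ε) * fromℕ n)        ≡⟨ cong (½ *_) workers ⟩
  ½ * fromℕ (suc w-1)             ≤⟨ ℚ.*-monoˡ-≤-nonNeg ½ (fromℕ-mono-≤ w≤2r) ⟩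
  ½ * fromℕ (2 ℕ.* rounds)        ≡⟨ cong (½ *_) (fromℕ-homo-* 2 rounds) ⟩
  ½ * (fromℕ 2 * fromℕ rounds)    ≡⟨ ℚ.*-assoc ½ (fromℕ 2) (fromℕ rounds) ⟨
  1ℚ * fromℕ rounds               ≡⟨ ℚ.*-identityˡ (fromℕ rounds) ⟩
  fromℕ rounds                    ∎
  where
  open NonadaptiveAlgorithm A using (rounds)
  open ℚ.≤-Reasoning
  w≤2r : suc w-1 ℕ.≤ 2 ℕ.* rounds
  -- With at least two slackers, n has the form 2 + m, so `zero` and `suc zero` are two distinct
  -- individuals.
  w≤2r = separates⇒workers≤2*rounds {x = zero} {suc zero} (λ ()) refl (identifies⇒separates A ident)

rounds≤3*workers : (n s : ℕ) (ε : ℚ) → SlackerFraction n s ε →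
  ∃[ A ] (IdentifiesAllSlackers {n} s A ×
    fromℕ (NonadaptiveAlgorithm.rounds A) ≤ fromℕ 3 * ((1ℚ - ε) * fromℕ n))
rounds≤3*workers n s ε sf with population sf
... | record { s-2 = s-2 ; w-1 = w-1 ; s≡ = refl ; s+w≡n = s+w≡n ; workers = workers } =
  exhaustiveSearch s schedule , separates⇒identifies separates , (begin
  fromℕ (length schedule)           ≡⟨ cong fromℕ (List.length-tabulate (reflectionRound ∘ sums)) ⟩
  fromℕ (2 ℕ.+ suc w-1)             ≤⟨ fromℕ-mono-≤ 2+w≤3w ⟩
  fromℕ (3 ℕ.* suc w-1)             ≡⟨ fromℕ-homo-* 3 (suc w-1) ⟩
  fromℕ 3 * fromℕ (suc w-1)         ≡⟨ cong (fromℕ 3 *_) workers ⟨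
  fromℕ 3 * ((1ℚ - ε) * fromℕ n)    ∎)
  where
  open Reflections {s = s-2} {suc w-1} s+w≡n
  open ℚ.≤-Reasoning
  -- As there is at least one worker, the additive 2 is at most twice their number; hence the
  -- constant 3.
  2+w≤3w : 2 ℕ.+ suc w-1 ℕ.≤ 3 ℕ.* suc w-1
  2+w≤3w = subst (ℕ._≤ 3 ℕ.* suc w-1) (ℕ.+-comm (suc w-1) 2)
    (ℕ.+-monoʳ-≤ (suc w-1) (ℕ.*-monoʳ-≤ 2 {1} {suc w-1} (s≤s z≤n)))

mainTheorem6 : (∃[ c ] (0ℚ < c ×
    ((n s : ℕ) (ε : ℚ) → SlackerFraction n s ε →
    (A : NonadaptiveAlgorithm n) → IdentifiesAllSlackers s A →
    c * ((1ℚ - ε) * fromℕ n) ≤ fromℕ (NonadaptiveAlgorithm.rounds A))))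
    ×
    (∃[ C ] (0ℚ < C ×
    ((n s : ℕ) (ε : ℚ) → SlackerFraction n s ε →
    ∃[ A ] (IdentifiesAllSlackers {n} s A ×
    fromℕ (NonadaptiveAlgorithm.rounds A) ≤ C * ((1ℚ - ε) * fromℕ n)))))
mainTheorem6 =
  (½ , ℚ.positive⁻¹ ½ , workers≤2*rounds) ,
  (fromℕ 3 , ℚ.positive⁻¹ (fromℕ 3) , rounds≤3*workers)
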